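{- For every set $\Gamma\cup\{\varphi\}\subseteq For_1(\Omega)$: $\Gamma\vdash_{\mathbf{RQmbC}}\varphi$ implies $\Gamma\models_{\mathbf{RQmbC}}\varphi$.
   Context: Let $\Sigma=\{\wedge,\vee,\to,\neg,\circ\}$ ($\neg,\circ$ unary). A first-order signature $\Omega$ extending $\Sigma$ consists of $\Sigma$ together with a (possibly empty) denumerable set $\mathcal C$ of individual constants and, for each $n\ge1$, (possibly empty) denumerable sets $\mathcal F_n$, $\mathcal P_n$ of $n$-ary function and predicate symbols, with $\bigcup_n\mathcal P_n\ne\emptyset$. $Var$ is a fixed denumerable set of individual variables. Terms are built from $Var\cup\mathcal C$ by function symbols; $For_1(\Omega)$ is generated from atomic formulas $P(\tau_1,\dots,\tau_n)$ by the connectives in $\Sigma$ and the quantifiers $\forall x,\exists x$ ($x\in Var$). $\alpha\leftrightarrow\beta$ abbreviates $(\alpha\to\beta)\wedge(\beta\to\alpha)$; $\varphi[x/t]$ is the substitution of $t$ for the free occurrences of $x$. $\mathbf{RQmbC}$ is the Hilbert calculus over $For_1(\Omega)$ with axiom schemas: (Ax1) $\alpha\to(\beta\to\alpha)$; (Ax2) $(\alpha\to(\beta\to\gamma))\to((\alpha\to\beta)\to(\alpha\to\gamma))$; (Ax3) $\alpha\to(\beta\to(\alpha\wedge\beta))$; (Ax4) $(\alpha\wedge\beta)\to\alpha$; (Ax5) $(\alpha\wedge\beta)\to\beta$; (Ax6) $\alpha\to(\alpha\vee\beta)$; (Ax7) $\beta\to(\alpha\vee\beta)$; (Ax8) $(\alpha\to\gamma)\to((\beta\to\gamma)\to((\alpha\vee\beta)\to\gamma))$;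 (Ax9) $(\alpha\to\beta)\vee\alpha$; (Ax10) $\alpha\vee\neg\alpha$; (bc1) $\circ\alpha\to(\alpha\to(\neg\alpha\to\beta))$; (Ax$\exists$) $\varphi[x/t]\to\exists x\varphi$ and (Ax$\forall$) $\forall x\varphi\to\varphi[x/t]$, for $t$ a term free for $x$ in $\varphi$; and rules: (MP) from $\alpha$, $\alpha\to\beta$ infer $\beta$; $(\mathbf R_\neg)$ from $\alpha\leftrightarrow\beta$ infer $\neg\alpha\leftrightarrow\neg\beta$; $(\mathbf R_\circ)$ from $\alpha\leftrightarrow\beta$ infer $\circ\alpha\leftrightarrow\circ\beta$; ($\exists$-In) from $\varphi\to\psi$ infer $\exists x\varphi\to\psi$, if $x$ is not free in $\psi$; ($\forall$-In) from $\varphi\to\psi$ infer $\varphi\to\forall x\psi$, if $x$ is not free in $\varphi$. $\vdash_{\mathbf{RQmbC}}\varphi$ means there is a finite sequence of formulas ending in $\varphi$ each of which is an instance of an axiom schema or follows from earlier ones by a rule. $\Gamma\vdash_{\mathbf{RQmbC}}\varphi$ means that either $\vdash_{\mathbf{RQmbC}}\varphi$ or there is a finite non-empty $\{\gamma_1,\dots,\gamma_n\}\subseteq\Gamma$ with $\vdash_{\mathbf{RQmbC}}(\gamma_1\wedge(\cdots\wedge(\gamma_{n-1}\wedge\gamma_n)\cdots))\to\varphi$. A BALFI is an algebra $\mathcal B=\langle A,\wedge,\vee,\to,\neg,\circ,0,1\rangle$ such that $\langle A,\wedge,\vee,\to,0,1\rangle$ is a Boolean algebra (with $\to$ the Boolean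 implication) and $a\vee\neg a=1$, $a\wedge\neg a\wedge\circ a=0$ for all $a\in A$; it is complete if its Boolean reduct is complete. A structure over $\Omega$ is $\mathfrak A=\langle U,\mathcal B,I_{\mathfrak A}\rangle$ with $U\neq\emptyset$, $\mathcal B$ a complete BALFI with carrier $A$, and $I_{\mathfrak A}$ interpreting each constant $c$ as $c^{\mathfrak A}\in U$, each $n$-ary function symbol $f$ as $f^{\mathfrak A}:U^n\to U$, each $n$-ary predicate symbol $P$ as $P^{\mathfrak A}:U^n\to A$. An assignment is $\mu:Var\to U$; $\mu^x_a$ agrees with $\mu$ except $\mu^x_a(x)=a$. Terms are interpreted as usual by $[\![t]\!]^{\mathfrak A}_\mu\in U$. Formulas are interpreted in $A$ by: $[\![P(t_1,\dots,t_n)]\!]_\mu=P^{\mathfrak A}([\![t_1]\!]_\mu,\dots,[\![t_n]\!]_\mu)$; $[\![\#\varphi]\!]_\mu=\#[\![\varphi]\!]_\mu$ for $\#\in\{\neg,\circ\}$; $[\![\varphi\#\psi]\!]_\mu=[\![\varphi]\!]_\mu\#[\![\psi]\!]_\mu$ for $\#\in\{\wedge,\vee,\to\}$; $[\![\forall x\varphi]\!]_\mu=\bigwedge_{a\in U}[\![\varphi]\!]_{\mu^x_a}$; $[\![\exists x\varphi]\!]_\mu=\bigvee_{a\in U}[\![\varphi]\!]_{\mu^x_a}$. $\models_{\mathbf{RQmbC}}\varphi$ means $[\![\varphi]\!]^{\mathfrak A}_\mu=1$ for every structure $\mathfrak A$ over $\Omega$ and every assignment $\mu$. $\Gamma\models_{\mathbf{RQmbC}}\varphi$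 means that either $\models_{\mathbf{RQmbC}}\varphi$ or there is a finite non-empty $\{\gamma_1,\dots,\gamma_n\}\subseteq\Gamma$ with $\models_{\mathbf{RQmbC}}(\gamma_1\wedge\cdots\wedge\gamma_n)\to\varphi$. -}

module Defs where

open import Algebra.Core using (Op₁)
open import Algebra.Definitions using (Congruent₁)
open import Algebra.Lattice.Bundles using (BooleanAlgebra)
import Algebra.Lattice.Properties.BooleanAlgebra as BooleanAlgebraProperties
open import Data.List.Base using (List; []; _∷_)
open import Data.List.Membership.Propositional using (_∈_)
open import Data.List.NonEmpty.Base using (List⁺; foldr₁)
open import Data.List.NonEmpty.Relation.Unary.All using (All)
open import Data.Nat.Base using (ℕ; suc)
open import Data.Nat.Properties using (_≟_)
open import Data.Product.Base using (∃; _×_; proj₁)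
open import Data.Sum.Base using (_⊎_)
open import Data.Unit.Base using (⊤)
open import Data.Vec.Base using (Vec; []; _∷_)
open import Data.Vec.Relation.Unary.Any using (Any)
open import Data.Bool.Base using (if_then_else_)
open import Function.Bundles using (_↣_)
open import Level using (Level; _⊔_) renaming (suc to lsuc)
open import Relation.Binary.Bundles using (Poset)
open import Relation.Binary.PropositionalEquality.Core using (_≢_)
open import Relation.Nullary.Decidable.Core using (⌊_⌋)
open import Relation.Nullary.Negation.Core using (¬_)
open import Relation.Unary using (Pred)

------------------------------------------------------------------------
-- Syntax

-- "Denumerable, possibly empty": finite or countably infinite.
Denumerable : Set → Set
Denumerable A = A ↣ ℕ

Var : Set
Var = ℕ

-- Arities are at least 1, so FunSym n and PredSym n are the symbols of
-- arity suc n.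
record Signature : Set₁ where
  field
    Const               : Set
    FunSym PredSym      : ℕ → Set
    Const-denumerable   : Denumerable Const
    FunSym-denumerable  : ∀ n → Denumerable (FunSym n)
    PredSym-denumerable : ∀ n → Denumerable (PredSym n)
    PredSym-nonempty    : ∃ λ n → PredSym n

module _ (Ω : Signature) where
  open Signature Ω

  data Term : Set where
    var : Var → Term
    con : Const → Term
    fun : ∀ {n} → FunSym n → Vec Term (suc n) → Term

  infix  9 ¬̇_ ∘̇_
  infixr 8 _∧̇_
  infixr 7 _∨̇_
  infixr 6 _→̇_

  data Formula : Set where
    atom           : ∀ {n} → PredSym n → Vec Term (suc n) → Formula
    _∧̇_ _∨̇_ _→̇_ : Formula → Formula → Formula
    ¬̇_ ∘̇_        : Formula → Formula
    ∀̇ ∃̇          : Var → Formula → Formula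

module _ {Ω : Signature} where

  infix 5 _↔̇_

  _↔̇_ : Formula Ω → Formula Ω → Formula Ω
  α ↔̇ β = (α →̇ β) ∧̇ (β →̇ α)

  -- γ₁ ∧ (⋯ ∧ (γₙ₋₁ ∧ γₙ)⋯)
  ⋀̇ : List⁺ (Formula Ω) → Formula Ω
  ⋀̇ = foldr₁ _∧̇_

  data _OccursIn_ (x : Var) : Term Ω → Set where
    var : x OccursIn var x
    fun : ∀ {n f} {ts : Vec (Term Ω) (suc n)} →
          Any (x OccursIn_) ts → x OccursIn fun f ts

  _FreeIn_ : Var → Formula Ω → Set
  x FreeIn atom P ts = Any (x OccursIn_) ts
  x FreeIn (α ∧̇ β)  = x FreeIn α ⊎ x FreeIn β
  x FreeIn (α ∨̇ β)  = x FreeIn α ⊎ x FreeIn β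
  x FreeIn (α →̇ β)  = x FreeIn α ⊎ x FreeIn β
  x FreeIn (¬̇ α)    = x FreeIn α
  x FreeIn (∘̇ α)    = x FreeIn α
  x FreeIn (∀̇ y α)  = x ≢ y × x FreeIn α
  x FreeIn (∃̇ y α)  = x ≢ y × x FreeIn α

  -- No free occurrence of x in the formula lies in the scope of a
  -- quantifier binding a variable of t.
  _FreeFor_In_ : Term Ω → Var → Formula Ω → Set
  t FreeFor x In atom P ts = ⊤
  t FreeFor x In (α ∧̇ β)  = t FreeFor x In α × t FreeFor x In β
  t FreeFor x In (α ∨̇ β)  = t FreeFor x In α × t FreeFor x In β
  t FreeFor x In (α →̇ β)  = t FreeFor x In α × t FreeFor x In β
  t FreeFor x In (¬̇ α)    = t FreeFor x In α
  t FreeFor x In (∘̇ α)    = t FreeFor x In α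
  t FreeFor x In (∀̇ y α)  = ¬ (x FreeIn ∀̇ y α) ⊎ (¬ (y OccursIn t) × t FreeFor x In α)
  t FreeFor x In (∃̇ y α)  = ¬ (x FreeIn ∃̇ y α) ⊎ (¬ (y OccursIn t) × t FreeFor x In α)

  mutual
    _[_/_]ᵗ : Term Ω → Var → Term Ω → Term Ω
    var y    [ x / t ]ᵗ = if ⌊ x ≟ y ⌋ then t else var y
    con c    [ x / t ]ᵗ = con c
    fun f ts [ x / t ]ᵗ = fun f (ts [ x / t ]ᵗˢ)

    _[_/_]ᵗˢ : ∀ {n} → Vec (Term Ω) n → Var → Term Ω → Vec (Term Ω) n
    []       [ x / t ]ᵗˢ = []
    (s ∷ ss) [ x / t ]ᵗˢ = (s [ x / t ]ᵗ) ∷ (ss [ x / t ]ᵗˢ)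

  -- Bound variables are never renamed; capture is excluded only by
  -- _FreeFor_In_.
  _[_/_] : Formula Ω → Var → Term Ω → Formula Ω
  atom P ts [ x / t ] = atom P (ts [ x / t ]ᵗˢ)
  (α ∧̇ β)  [ x / t ] = (α [ x / t ]) ∧̇ (β [ x / t ])
  (α ∨̇ β)  [ x / t ] = (α [ x / t ]) ∨̇ (β [ x / t ])
  (α →̇ β)  [ x / t ] = (α [ x / t ]) →̇ (β [ x / t ])
  (¬̇ α)    [ x / t ] = ¬̇ (α [ x / t ])
  (∘̇ α)    [ x / t ] = ∘̇ (α [ x / t ])
  ∀̇ y α    [ x / t ] = if ⌊ x ≟ y ⌋ then ∀̇ y α else ∀̇ y (α [ x / t ])
  ∃̇ y α    [ x / t ] = if ⌊ x ≟ y ⌋ then ∃̇ y α else ∃̇ y (α [ x / t ])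

------------------------------------------------------------------------
-- The Hilbert calculus RQmbC

  data Axiom : Formula Ω → Set where
    ax1  : ∀ α β   → Axiom (α →̇ (β →̇ α))
    ax2  : ∀ α β γ → Axiom ((α →̇ (β →̇ γ)) →̇ ((α →̇ β) →̇ (α →̇ γ)))
    ax3  : ∀ α β   → Axiom (α →̇ (β →̇ (α ∧̇ β)))
    ax4  : ∀ α β   → Axiom ((α ∧̇ β) →̇ α)
    ax5  : ∀ α β   → Axiom ((α ∧̇ β) →̇ β)
    ax6  : ∀ α β   → Axiom (α →̇ (α ∨̇ β))
    ax7  : ∀ α β   → Axiom (β →̇ (α ∨̇ β))
    ax8  : ∀ α β γ → Axiom ((α →̇ γ) →̇ ((β →̇ γ) →̇ ((α ∨̇ β) →̇ γ)))
    ax9  : ∀ α β   → Axiom ((α →̇ β) ∨̇ α)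
    ax10 : ∀ α     → Axiom (α ∨̇ ¬̇ α)
    bc1  : ∀ α β   → Axiom (∘̇ α →̇ (α →̇ (¬̇ α →̇ β)))
    ax∃  : ∀ φ x t → t FreeFor x In φ → Axiom ((φ [ x / t ]) →̇ ∃̇ x φ)
    ax∀  : ∀ φ x t → t FreeFor x In φ → Axiom (∀̇ x φ →̇ (φ [ x / t ]))

  -- Step Δ φ: φ may be written down after the formulas in Δ.
  data Step (Δ : List (Formula Ω)) : Formula Ω → Set where
    axiom : ∀ {α} → Axiom α → Step Δ α
    MP    : ∀ {α β} → α ∈ Δ → (α →̇ β) ∈ Δ → Step Δ β
    R¬    : ∀ {α β} → (α ↔̇ β) ∈ Δ → Step Δ (¬̇ α ↔̇ ¬̇ β)
    R∘    : ∀ {α β} → (α ↔̇ β) ∈ Δ → Step Δ (∘̇ α ↔̇ ∘̇ β)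
    ∃-In  : ∀ {φ ψ} x → ¬ (x FreeIn ψ) → (φ →̇ ψ) ∈ Δ → Step Δ (∃̇ x φ →̇ ψ)
    ∀-In  : ∀ {φ ψ} x → ¬ (x FreeIn φ) → (φ →̇ ψ) ∈ Δ → Step Δ (φ →̇ ∀̇ x ψ)

  -- Finite derivation sequences, listed with the last formula first.
  data Derivation : List (Formula Ω) → Set where
    []  : Derivation []
    _∷_ : ∀ {φ Δ} → Step Δ φ → Derivation Δ → Derivation (φ ∷ Δ)

  infix 4 ⊢_ _⊢_

  ⊢_ : Formula Ω → Set
  ⊢ φ = ∃ λ Δ → Derivation (φ ∷ Δ)

  _⊢_ : ∀ {ℓ} → Pred (Formula Ω) ℓ → Formula Ω → Set ℓ
  Γ ⊢ φ = ⊢ φ ⊎ ∃ λ γs → All Γ γs × ⊢ (⋀̇ γs →̇ φ)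

------------------------------------------------------------------------
-- BALFIs

record BALFI (a e : Level) : Set (lsuc (a ⊔ e)) where
  field
    booleanAlgebra : BooleanAlgebra a e

  open BooleanAlgebra booleanAlgebra public
    using (Carrier; _≈_; _∧_; _∨_)
    renaming (¬_ to ∼_; ⊥ to 𝟎; ⊤ to 𝟏)

  infix 8 ¬ᴮ_ ∘ᴮ_

  -- ¬ᴮ and ∘ᴮ are additional operations; ∼ is the Boolean complement.
  field
    ¬ᴮ_ ∘ᴮ_ : Op₁ Carrier
    ¬ᴮ-cong : Congruent₁ _≈_ ¬ᴮ_
    ∘ᴮ-cong : Congruent₁ _≈_ ∘ᴮ_
    ∨-¬ᴮ    : ∀ b → b ∨ ¬ᴮ b ≈ 𝟏
    ∧-¬ᴮ-∘ᴮ : ∀ b → (b ∧ ¬ᴮ b) ∧ ∘ᴮ b ≈ 𝟎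

  infixr 5 _⇒_

  _⇒_ : Carrier → Carrier → Carrier
  b ⇒ c = ∼ b ∨ c

  -- b ≤ c unfolds to b ≈ b ∧ c.
  open Poset (BooleanAlgebraProperties.poset booleanAlgebra) public
    using (_≤_)

module _ {a e ι} (𝓑 : BALFI a e) {I : Set ι} where
  open BALFI 𝓑

  record IsSupremum (f : I → Carrier) (s : Carrier) : Set (a ⊔ e ⊔ ι) where
    field
      upper : ∀ i → f i ≤ s
      least : ∀ b → (∀ i → f i ≤ b) → s ≤ b

  record IsInfimum (f : I → Carrier) (m : Carrier) : Set (a ⊔ e ⊔ ι) where
    field
      lower    : ∀ i → m ≤ f i
      greatest : ∀ b → (∀ i → b ≤ f i) → b ≤ m

-- Completeness is stated for families indexed by types in Set ι; a
-- subset S : Pred Carrier _ is the family proj₁ on ∃ S.  The level ι is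
-- independent of that of the carrier because, predicatively, nontrivial
-- complete Boolean algebras typically live one universe above the
-- families whose bounds they contain.
record IsComplete {a e} ι (𝓑 : BALFI a e) : Set (a ⊔ e ⊔ lsuc ι) where
  open BALFI 𝓑
  field
    sup : ∀ {I : Set ι} (f : I → Carrier) → ∃ (IsSupremum 𝓑 f)
    inf : ∀ {I : Set ι} (f : I → Carrier) → ∃ (IsInfimum 𝓑 f)

  ⋁ ⋀ : ∀ {I : Set ι} → (I → Carrier) → Carrier
  ⋁ f = proj₁ (sup f)
  ⋀ f = proj₁ (inf f)

------------------------------------------------------------------------
-- Structures and semantic consequence

record Structure (Ω : Signature) (ι a e : Level) : Set (lsuc (ι ⊔ a ⊔ e)) where
  open Signature Ω
  field
    U          : Set ι
    U-nonempty : U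
    𝓑          : BALFI a e
    complete   : IsComplete ι 𝓑

  open BALFI 𝓑 public
  open IsComplete complete public using (⋁; ⋀)

  field
    ⟦_⟧ᶜ : Const → U
    ⟦_⟧ᶠ : ∀ {n} → FunSym n → Vec U (suc n) → U
    ⟦_⟧ᴾ : ∀ {n} → PredSym n → Vec U (suc n) → Carrier

_[_↦_] : ∀ {u} {U : Set u} → (Var → U) → Var → U → (Var → U)
(μ [ x ↦ d ]) y = if ⌊ x ≟ y ⌋ then d else μ y

module _ {Ω : Signature} where

  module _ {ι a e} (𝔄 : Structure Ω ι a e) where
    open Structure 𝔄

    mutual
      evalTerm : (Var → U) → Term Ω → U
      evalTerm μ (var x)    = μ x
      evalTerm μ (con c)    = ⟦ c ⟧ᶜ
      evalTerm μ (fun f ts) = ⟦ f ⟧ᶠ (evalTerms μ ts)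

      evalTerms : ∀ {n} → (Var → U) → Vec (Term Ω) n → Vec U n
      evalTerms μ []       = []
      evalTerms μ (t ∷ ts) = evalTerm μ t ∷ evalTerms μ ts

    eval : (Var → U) → Formula Ω → Carrier
    eval μ (atom P ts) = ⟦ P ⟧ᴾ (evalTerms μ ts)
    eval μ (α ∧̇ β)    = eval μ α ∧ eval μ β
    eval μ (α ∨̇ β)    = eval μ α ∨ eval μ β
    eval μ (α →̇ β)    = eval μ α ⇒ eval μ β
    eval μ (¬̇ α)      = ¬ᴮ eval μ α
    eval μ (∘̇ α)      = ∘ᴮ eval μ α
    eval μ (∀̇ x α)    = ⋀ λ d → eval (μ [ x ↦ d ]) α
    eval μ (∃̇ x α)    = ⋁ λ d → eval (μ [ x ↦ d ]) α

  -- The levels bound the sizes of the domain, the carrier and its equality.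
  Valid : (ι a e : Level) → Formula Ω → Set (lsuc (ι ⊔ a ⊔ e))
  Valid ι a e φ = (𝔄 : Structure Ω ι a e) (μ : Var → Structure.U 𝔄) →
                  Structure._≈_ 𝔄 (eval 𝔄 μ φ) (Structure.𝟏 𝔄)

  Entails : ∀ {ℓ} (ι a e : Level) → Pred (Formula Ω) ℓ → Formula Ω →
            Set (ℓ ⊔ lsuc (ι ⊔ a ⊔ e))
  Entails ι a e Γ φ =
    Valid ι a e φ ⊎ ∃ λ γs → All Γ γs × Valid ι a e (⋀̇ γs →̇ φ)

{-# OPTIONS --safe #-}

-- In a complete BALFI the value of α → β is 1 exactly when the value of α
-- lies below that of β, so the propositional axioms follow from the fact
-- that a Boolean algebra is a Heyting algebra, and R¬ and R∘ hold because
-- α ↔ β has value 1 only if α and β have equal values.  The quantifier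
-- axioms and rules reduce to the substitution lemma
-- ⟦φ[x/t]⟧μ = ⟦φ⟧μ[x ↦ ⟦t⟧μ], for t free for x in φ, and to the fact that
-- ⟦φ⟧μ depends only on the values of μ at the free variables of φ.

module Submission where

open import Defs
open import Level using (Level)
open import Relation.Unary using (Pred)

import Algebra.Lattice.Bundles as Algebraic
import Algebra.Lattice.Properties.BooleanAlgebra as BooleanAlgebraProperties
open import Data.Empty using (⊥-elim)
open import Data.List.Relation.Unary.All as List using ([]; _∷_)
open import Data.Nat.Properties using (_≟_)
open import Data.Product.Base using (_,_; proj₂)
open import Data.Sum.Base using (inj₁; inj₂)
open import Data.Vec.Base using (Vec; []; _∷_)
open import Data.Vec.Relation.Unary.Any using (Any; here; there)
open import Function.Base using (_∘_)
open import Relation.Binary.Lattice.Bundles using (HeytingAlgebra; Lattice)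
import Relation.Binary.Lattice.Properties.HeytingAlgebra as HeytingAlgebraProperties
import Relation.Binary.Lattice.Properties.JoinSemilattice as JoinSemilatticeProperties
import Relation.Binary.Lattice.Properties.MeetSemilattice as MeetSemilatticeProperties
import Relation.Binary.Reasoning.PartialOrder as ≤-Reasoning
open import Relation.Binary.PropositionalEquality
  using (_≡_; _≢_; refl; sym; cong; cong₂)
open import Relation.Nullary using (¬_; yes; no)

-- Updating an assignment at one variable.

module _ {u} {U : Set u} where

  update-≢ : ∀ (μ : Var → U) {x y} d → x ≢ y → (μ [ x ↦ d ]) y ≡ μ y
  update-≢ μ {x} {y} d x≢y with x ≟ y
  ... | yes x≡y = ⊥-elim (x≢y x≡y)
  ... | no  _   = refl

  -- Agreement is asked only away from `x`, since the update overrides both assignments there. This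
  -- is exactly what is known on passing under a quantifier over `x`.
  update-cong : ∀ (μ ν : Var → U) x d {y} → (y ≢ x → μ y ≡ ν y) →
                (μ [ x ↦ d ]) y ≡ (ν [ x ↦ d ]) y
  update-cong μ ν x d {y} μ≡ν with x ≟ y
  ... | yes _   = refl
  ... | no  x≢y = μ≡ν (x≢y ∘ sym)

  -- Swaps the update made by a quantifier with the one made by a substitution. It is pointwise
  -- because `eval-cong` takes agreement in that form.
  update-comm : ∀ (μ : Var → U) {x y} d e → x ≢ y → ∀ z →
                (μ [ y ↦ d ] [ x ↦ e ]) z ≡ (μ [ x ↦ e ] [ y ↦ d ]) z
  update-comm μ {x} {y} d e x≢y z with x ≟ z | y ≟ z
  ... | yes refl | yes refl = ⊥-elim (x≢y refl)
  ... | yes refl | no  _    = refl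
  ... | no  _    | yes refl = refl
  ... | no  _    | no  _    = refl

-- Substitution for a variable without free occurrences.

module _ {Ω : Signature} {x : Var} {t : Term Ω} where

  mutual
    []ᵗ-fresh : ∀ s → ¬ (x OccursIn s) → s [ x / t ]ᵗ ≡ s
    []ᵗ-fresh (var y) x∉s with x ≟ y
    ... | yes refl = ⊥-elim (x∉s var)
    ... | no  _    = refl
    []ᵗ-fresh (con c)    x∉s = refl
    []ᵗ-fresh (fun f ss) x∉s = cong (fun f) ([]ᵗˢ-fresh ss (x∉s ∘ fun))

    []ᵗˢ-fresh : ∀ {n} (ss : Vec (Term Ω) n) → ¬ Any (x OccursIn_) ss →
                 ss [ x / t ]ᵗˢ ≡ ss
    []ᵗˢ-fresh []       x∉ss = refl
    []ᵗˢ-fresh (s ∷ ss) x∉ss =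
      cong₂ _∷_ ([]ᵗ-fresh s (x∉ss ∘ here)) ([]ᵗˢ-fresh ss (x∉ss ∘ there))

  []-fresh : ∀ φ → ¬ (x FreeIn φ) → φ [ x / t ] ≡ φ
  []-fresh (atom P ts) x∉ = cong (atom P) ([]ᵗˢ-fresh ts x∉)
  []-fresh (α ∧̇ β) x∉ = cong₂ _∧̇_ ([]-fresh α (x∉ ∘ inj₁)) ([]-fresh β (x∉ ∘ inj₂))
  []-fresh (α ∨̇ β) x∉ = cong₂ _∨̇_ ([]-fresh α (x∉ ∘ inj₁)) ([]-fresh β (x∉ ∘ inj₂))
  []-fresh (α →̇ β) x∉ = cong₂ _→̇_ ([]-fresh α (x∉ ∘ inj₁)) ([]-fresh β (x∉ ∘ inj₂))
  []-fresh (¬̇ α)   x∉ = cong ¬̇_ ([]-fresh α x∉)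
  []-fresh (∘̇ α)   x∉ = cong ∘̇_ ([]-fresh α x∉)
  []-fresh (∀̇ y α) x∉ with x ≟ y
  ... | yes _   = refl
  ... | no  x≢y = cong (∀̇ y) ([]-fresh α (x∉ ∘ (x≢y ,_)))
  []-fresh (∃̇ y α) x∉ with x ≟ y
  ... | yes _   = refl
  ... | no  x≢y = cong (∃̇ y) ([]-fresh α (x∉ ∘ (x≢y ,_)))

-- Boolean algebras as Heyting algebras.

module _ {a e} (B : Algebraic.BooleanAlgebra a e) where
  open Algebraic.BooleanAlgebra B renaming (¬_ to ∼_; sym to ≈-sym)
  private module P = BooleanAlgebraProperties B
  private module L = Lattice P.∨-∧-orderTheoreticLattice
  open L using (_≤_)
  open MeetSemilatticeProperties L.meetSemilattice using (∧-monotonic)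
  open JoinSemilatticeProperties L.joinSemilattice using (∨-monotonic)
  open ≤-Reasoning L.poset

  -- Split `w` along `∼ x ∨ x`: one part lies below `∼ x`, the other below `y` by hypothesis.
  ∧≤⇒≤∼∨ : ∀ {w x y} → w ∧ x ≤ y → w ≤ ∼ x ∨ y
  ∧≤⇒≤∼∨ {w} {x} {y} w∧x≤y = begin
    w                    ≈⟨ P.∧-identityʳ w ⟨
    w ∧ ⊤                ≈⟨ ∧-congˡ (∨-complementˡ x) ⟨
    w ∧ (∼ x ∨ x)        ≈⟨ ∧-distribˡ-∨ w (∼ x) x ⟩
    (w ∧ ∼ x) ∨ (w ∧ x)  ≤⟨ ∨-monotonic (L.x∧y≤y w (∼ x)) w∧x≤y ⟩
    ∼ x ∨ y              ∎

  ≤∼∨⇒∧≤ : ∀ {w x y} → w ≤ ∼ x ∨ y → w ∧ x ≤ y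
  ≤∼∨⇒∧≤ {w} {x} {y} w≤∼x∨y = begin
    w ∧ x                ≤⟨ ∧-monotonic w≤∼x∨y L.refl ⟩
    (∼ x ∨ y) ∧ x        ≈⟨ ∧-distribʳ-∨ x (∼ x) y ⟩
    (∼ x ∧ x) ∨ (y ∧ x)  ≈⟨ ∨-congʳ (∧-complementˡ x) ⟩
    ⊥ ∨ (y ∧ x)          ≈⟨ P.∨-identityˡ (y ∧ x) ⟩
    y ∧ x                ≤⟨ L.x∧y≤x y x ⟩
    y                    ∎

  -- The exponential is inferred to be `∼ x ∨ y`, which is how a BALFI defines `_⇒_`, so facts about
  -- Heyting implication apply to the values of implications as they stand. As `x ≤ y` unfolds to
  -- `x ≈ x ∧ y`, the bounds are the laws for top and bottom under meet, reversed.
  heytingAlgebra : HeytingAlgebra a e e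
  heytingAlgebra = record
    { isHeytingAlgebra = record
      { isBoundedLattice = record
        { isLattice = L.isLattice
        ; maximum   = λ x → ≈-sym (P.∧-identityʳ x)
        ; minimum   = λ x → ≈-sym (P.∧-zeroˡ x)
        }
      ; exponential = λ _ _ _ → ∧≤⇒≤∼∨ , ≤∼∨⇒∧≤
      }
    }

-- Implication, negation and consistency in a BALFI.

module BALFIProperties {a e} (𝓑 : BALFI a e) where
  open BALFI 𝓑
  open Algebraic.BooleanAlgebra booleanAlgebra public
    using (∧-cong; ∨-cong; ∨-complementˡ)
  open HeytingAlgebra (heytingAlgebra booleanAlgebra) public
    using (module Eq; poset; antisym; reflexive; trans; maximum; minimum; transpose-⇨; transpose-∧;
           x∧y≤x; x∧y≤y; ∧-greatest; x≤x∨y; y≤x∨y; meetSemilattice; joinSemilattice)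
    renaming (refl to ≤-refl)
  open HeytingAlgebraProperties (heytingAlgebra booleanAlgebra) public
    using (⇨-eval; y≤x⇨y; ⇨-cong; ⇨-distribˡ-∨-∧-≥)
  open MeetSemilatticeProperties meetSemilattice using (∧-monotonic)
  open JoinSemilatticeProperties joinSemilattice using (∨-monotonic)
  open ≤-Reasoning poset

  ≤⇒⇒≈𝟏 : ∀ {b c} → b ≤ c → b ⇒ c ≈ 𝟏
  ≤⇒⇒≈𝟏 b≤c = antisym (maximum _) (transpose-⇨ (trans (x∧y≤y _ _) b≤c))

  ⇒≈𝟏⇒≤ : ∀ {b c} → b ⇒ c ≈ 𝟏 → b ≤ c
  ⇒≈𝟏⇒≤ b⇒c≈𝟏 =
    trans (∧-greatest (maximum _) ≤-refl) (transpose-∧ (reflexive (Eq.sym b⇒c≈𝟏)))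

  𝟏≤⇒≈𝟏 : ∀ {b} → 𝟏 ≤ b → b ≈ 𝟏
  𝟏≤⇒≈𝟏 = antisym (maximum _)

  -- `𝟏` lies below both conjuncts, so `b` and `c` lie below each other. An equality is what the
  -- rules for `¬ᴮ` and `∘ᴮ` call for: these operations are congruent but not assumed monotone.
  ⇔≈𝟏⇒≈ : ∀ {b c} → (b ⇒ c) ∧ (c ⇒ b) ≈ 𝟏 → b ≈ c
  ⇔≈𝟏⇒≈ p = antisym (⇒≈𝟏⇒≤ (𝟏≤⇒≈𝟏 (trans 𝟏≤ (x∧y≤x _ _))))
                     (⇒≈𝟏⇒≤ (𝟏≤⇒≈𝟏 (trans 𝟏≤ (x∧y≤y _ _))))
    where 𝟏≤ = reflexive (Eq.sym p)

  ≈⇒⇔≈𝟏 : ∀ {b c} → b ≈ c → (b ⇒ c) ∧ (c ⇒ b) ≈ 𝟏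
  ≈⇒⇔≈𝟏 b≈c = 𝟏≤⇒≈𝟏 (∧-greatest
    (reflexive (Eq.sym (≤⇒⇒≈𝟏 (reflexive b≈c))))
    (reflexive (Eq.sym (≤⇒⇒≈𝟏 (reflexive (Eq.sym b≈c))))))

  -- After two transpositions, modus ponens with `b` yields `c ⇒ d` and `c`, and a third use yields
  -- `d`.
  ⇒-distrib : ∀ b c d → b ⇒ c ⇒ d ≤ (b ⇒ c) ⇒ b ⇒ d
  ⇒-distrib b c d = transpose-⇨ (transpose-⇨ (trans
    (∧-greatest (trans (∧-monotonic (x∧y≤x _ _) ≤-refl) ⇨-eval)
                (trans (∧-monotonic (x∧y≤y _ _) ≤-refl) ⇨-eval))
    ⇨-eval))

  -- Excluded middle for the Boolean complement: `∼ b ∨ b` is already `𝟏`, and `∼ b` lies below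
  -- `b ⇒ c`.
  ⇒-∨-𝟏 : ∀ b c → (b ⇒ c) ∨ b ≈ 𝟏
  ⇒-∨-𝟏 b c = 𝟏≤⇒≈𝟏 (begin
    𝟏            ≈⟨ ∨-complementˡ b ⟨
    ∼ b ∨ b      ≤⟨ ∨-monotonic (x≤x∨y (∼ b) c) ≤-refl ⟩
    (b ⇒ c) ∨ b  ∎)

  ∘ᴮ-explosion : ∀ b c → ∘ᴮ b ≤ b ⇒ ¬ᴮ b ⇒ c
  ∘ᴮ-explosion b c = transpose-⇨ (transpose-⇨ (begin
    (∘ᴮ b ∧ b) ∧ ¬ᴮ b  ≤⟨ ∧-greatest (∧-monotonic (x∧y≤y _ _) ≤-refl)
                                     (trans (x∧y≤x _ _) (x∧y≤x _ _)) ⟩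
    (b ∧ ¬ᴮ b) ∧ ∘ᴮ b  ≈⟨ ∧-¬ᴮ-∘ᴮ b ⟩
    𝟎                  ≤⟨ minimum c ⟩
    c                  ∎))

-- Suprema and infima over the domain of a structure.

module _ {Ω : Signature} {ι a e} (𝔄 : Structure Ω ι a e) where
  open Structure 𝔄
  open BALFIProperties 𝓑

  module _ (f : U → Carrier) where
    open IsSupremum (proj₂ (IsComplete.sup complete f)) public
      renaming (upper to ⋁-upper; least to ⋁-least)
    open IsInfimum (proj₂ (IsComplete.inf complete f)) public
      renaming (lower to ⋀-lower; greatest to ⋀-greatest)

  ⋁-mono : ∀ {f g : U → Carrier} → (∀ d → f d ≤ g d) → ⋁ f ≤ ⋁ g
  ⋁-mono {f} {g} f≤g = ⋁-least f _ λ d → trans (f≤g d) (⋁-upper g d)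

  ⋀-mono : ∀ {f g : U → Carrier} → (∀ d → f d ≤ g d) → ⋀ f ≤ ⋀ g
  ⋀-mono {f} {g} f≤g = ⋀-greatest g _ λ d → trans (⋀-lower f d) (f≤g d)

  -- Completeness chooses a bound for each family separately; that the choice respects pointwise
  -- equality follows because the order determines a supremum up to `≈`.
  ⋁-cong : ∀ {f g : U → Carrier} → (∀ d → f d ≈ g d) → ⋁ f ≈ ⋁ g
  ⋁-cong f≈g = antisym (⋁-mono (reflexive ∘ f≈g)) (⋁-mono (reflexive ∘ Eq.sym ∘ f≈g))

  ⋀-cong : ∀ {f g : U → Carrier} → (∀ d → f d ≈ g d) → ⋀ f ≈ ⋀ g
  ⋀-cong f≈g = antisym (⋀-mono (reflexive ∘ f≈g)) (⋀-mono (reflexive ∘ Eq.sym ∘ f≈g))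

  -- Dependence of values on the free variables only.

  mutual
    evalTerm-cong : ∀ {μ ν} t → (∀ z → z OccursIn t → μ z ≡ ν z) →
                    evalTerm 𝔄 μ t ≡ evalTerm 𝔄 ν t
    evalTerm-cong (var x)    μ≡ν = μ≡ν x var
    evalTerm-cong (con c)    μ≡ν = refl
    evalTerm-cong (fun f ts) μ≡ν = cong ⟦ f ⟧ᶠ (evalTerms-cong ts λ z → μ≡ν z ∘ fun)

    evalTerms-cong : ∀ {μ ν n} (ts : Vec (Term Ω) n) →
                     (∀ z → Any (z OccursIn_) ts → μ z ≡ ν z) →
                     evalTerms 𝔄 μ ts ≡ evalTerms 𝔄 ν ts
    evalTerms-cong []       μ≡ν = refl
    evalTerms-cong (t ∷ ts) μ≡ν =
      cong₂ _∷_ (evalTerm-cong t λ z → μ≡ν z ∘ here)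
                (evalTerms-cong ts λ z → μ≡ν z ∘ there)

  eval-cong : ∀ {μ ν} φ → (∀ z → z FreeIn φ → μ z ≡ ν z) → eval 𝔄 μ φ ≈ eval 𝔄 ν φ
  eval-cong (atom P ts) μ≡ν = Eq.reflexive (cong ⟦ P ⟧ᴾ (evalTerms-cong ts μ≡ν))
  eval-cong (α ∧̇ β) μ≡ν =
    ∧-cong (eval-cong α λ z → μ≡ν z ∘ inj₁) (eval-cong β λ z → μ≡ν z ∘ inj₂)
  eval-cong (α ∨̇ β) μ≡ν =
    ∨-cong (eval-cong α λ z → μ≡ν z ∘ inj₁) (eval-cong β λ z → μ≡ν z ∘ inj₂)
  eval-cong (α →̇ β) μ≡ν =
    ⇨-cong (eval-cong α λ z → μ≡ν z ∘ inj₁) (eval-cong β λ z → μ≡ν z ∘ inj₂)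
  eval-cong (¬̇ α)   μ≡ν = ¬ᴮ-cong (eval-cong α μ≡ν)
  eval-cong (∘̇ α)   μ≡ν = ∘ᴮ-cong (eval-cong α μ≡ν)
  eval-cong {μ} {ν} (∀̇ y α) μ≡ν = ⋀-cong λ d →
    eval-cong α λ z z∈α → update-cong μ ν y d λ z≢y → μ≡ν z (z≢y , z∈α)
  eval-cong {μ} {ν} (∃̇ y α) μ≡ν = ⋁-cong λ d →
    eval-cong α λ z z∈α → update-cong μ ν y d λ z≢y → μ≡ν z (z≢y , z∈α)

  eval-update-fresh : ∀ {μ x} d φ → ¬ (x FreeIn φ) → eval 𝔄 (μ [ x ↦ d ]) φ ≈ eval 𝔄 μ φ
  eval-update-fresh {μ} d φ x∉φ =
    eval-cong φ λ z z∈φ → update-≢ μ d λ { refl → x∉φ z∈φ }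

  -- The substitution lemma.

  module _ {x : Var} {t : Term Ω} where

    mutual
      evalTerm-[] : ∀ μ s → evalTerm 𝔄 μ (s [ x / t ]ᵗ) ≡
                            evalTerm 𝔄 (μ [ x ↦ evalTerm 𝔄 μ t ]) s
      evalTerm-[] μ (var y) with x ≟ y
      ... | yes _ = refl
      ... | no  _ = refl
      evalTerm-[] μ (con c)    = refl
      evalTerm-[] μ (fun f ss) = cong ⟦ f ⟧ᶠ (evalTerms-[] μ ss)

      evalTerms-[] : ∀ μ {n} (ss : Vec (Term Ω) n) →
                     evalTerms 𝔄 μ (ss [ x / t ]ᵗˢ) ≡
                     evalTerms 𝔄 (μ [ x ↦ evalTerm 𝔄 μ t ]) ss
      evalTerms-[] μ []       = refl
      evalTerms-[] μ (s ∷ ss) = cong₂ _∷_ (evalTerm-[] μ s) (evalTerms-[] μ ss)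

    -- Serves the alternative of `_FreeFor_In_` that says nothing about the body of the quantifier,
    -- hence offers no induction hypothesis: there the substitution and the update both have no
    -- effect.
    eval-[]-fresh : ∀ μ φ → ¬ (x FreeIn φ) →
                    eval 𝔄 μ (φ [ x / t ]) ≈ eval 𝔄 (μ [ x ↦ evalTerm 𝔄 μ t ]) φ
    eval-[]-fresh μ φ x∉φ = Eq.trans
      (Eq.reflexive (cong (eval 𝔄 μ) ([]-fresh φ x∉φ)))
      (Eq.sym (eval-update-fresh _ φ x∉φ))

    -- Absence of capture enters here: as `y` does not occur in `t`, updating `y` leaves the value
    -- of `t` alone, and then the two updates commute.
    eval-update-swap : ∀ μ {y} α d → x ≢ y → ¬ (y OccursIn t) →
                       eval 𝔄 (μ [ y ↦ d ] [ x ↦ evalTerm 𝔄 (μ [ y ↦ d ]) t ]) α ≈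
                       eval 𝔄 (μ [ x ↦ evalTerm 𝔄 μ t ] [ y ↦ d ]) α
    eval-update-swap μ {y} α d x≢y y∉t
      rewrite evalTerm-cong {μ [ y ↦ d ]} {μ} t
                (λ z z∈t → update-≢ μ d λ { refl → y∉t z∈t })
      = eval-cong α λ z _ → update-comm μ d (evalTerm 𝔄 μ t) x≢y z

    eval-[] : ∀ μ φ → t FreeFor x In φ →
              eval 𝔄 μ (φ [ x / t ]) ≈ eval 𝔄 (μ [ x ↦ evalTerm 𝔄 μ t ]) φ
    eval-[] μ (atom P ts) _       = Eq.reflexive (cong ⟦ P ⟧ᴾ (evalTerms-[] μ ts))
    eval-[] μ (α ∧̇ β)    (p , q) = ∧-cong (eval-[] μ α p) (eval-[] μ β q)
    eval-[] μ (α ∨̇ β)    (p , q) = ∨-cong (eval-[] μ α p) (eval-[] μ β q)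
    eval-[] μ (α →̇ β)    (p , q) = ⇨-cong (eval-[] μ α p) (eval-[] μ β q)
    eval-[] μ (¬̇ α)      p       = ¬ᴮ-cong (eval-[] μ α p)
    eval-[] μ (∘̇ α)      p       = ∘ᴮ-cong (eval-[] μ α p)
    eval-[] μ (∀̇ y α) (inj₁ x∉) = eval-[]-fresh μ (∀̇ y α) x∉
    eval-[] μ (∀̇ y α) (inj₂ (y∉t , p)) with x ≟ y
    -- The substitution stops at a binder of `x` itself, and the quantified formula ignores the
    -- update because `x` is bound in it.
    ... | yes refl = Eq.sym (eval-update-fresh _ (∀̇ x α) λ (x≢x , _) → x≢x refl)
    ... | no  x≢y  = ⋀-cong λ d →
      Eq.trans (eval-[] (μ [ y ↦ d ]) α p) (eval-update-swap μ α d x≢y y∉t)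
    eval-[] μ (∃̇ y α) (inj₁ x∉) = eval-[]-fresh μ (∃̇ y α) x∉
    eval-[] μ (∃̇ y α) (inj₂ (y∉t , p)) with x ≟ y
    ... | yes refl = Eq.sym (eval-update-fresh _ (∃̇ x α) λ (x≢x , _) → x≢x refl)
    ... | no  x≢y  = ⋁-cong λ d →
      Eq.trans (eval-[] (μ [ y ↦ d ]) α p) (eval-update-swap μ α d x≢y y∉t)

  -- Soundness of axioms, rules and derivations.

  True : Formula Ω → Set _
  True φ = ∀ μ → eval 𝔄 μ φ ≈ 𝟏

  axiom-sound : ∀ {φ} → Axiom φ → True φ
  axiom-sound (ax1 α β)      μ = ≤⇒⇒≈𝟏 y≤x⇨y
  axiom-sound (ax2 α β γ)    μ = ≤⇒⇒≈𝟏 (⇒-distrib _ _ _)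
  axiom-sound (ax3 α β)      μ = ≤⇒⇒≈𝟏 (transpose-⇨ ≤-refl)
  axiom-sound (ax4 α β)      μ = ≤⇒⇒≈𝟏 (x∧y≤x _ _)
  axiom-sound (ax5 α β)      μ = ≤⇒⇒≈𝟏 (x∧y≤y _ _)
  axiom-sound (ax6 α β)      μ = ≤⇒⇒≈𝟏 (x≤x∨y _ _)
  axiom-sound (ax7 α β)      μ = ≤⇒⇒≈𝟏 (y≤x∨y _ _)
  -- Uncurried, the axiom says that the meet of two implications lies below the implication from the
  -- join of their antecedents.
  axiom-sound (ax8 α β γ)    μ = ≤⇒⇒≈𝟏 (transpose-⇨ (⇨-distribˡ-∨-∧-≥ _ _ _))
  axiom-sound (ax9 α β)      μ = ⇒-∨-𝟏 _ _
  axiom-sound (ax10 α)       μ = ∨-¬ᴮ _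
  axiom-sound (bc1 α β)      μ = ≤⇒⇒≈𝟏 (∘ᴮ-explosion _ _)
  axiom-sound (ax∃ φ x t ff) μ =
    -- The value of `t` is the element of the domain that witnesses the existential.
    ≤⇒⇒≈𝟏 (trans (reflexive (eval-[] μ φ ff)) (⋁-upper _ (evalTerm 𝔄 μ t)))
  axiom-sound (ax∀ φ x t ff) μ =
    ≤⇒⇒≈𝟏 (trans (⋀-lower _ (evalTerm 𝔄 μ t)) (reflexive (Eq.sym (eval-[] μ φ ff))))

  step-sound : ∀ {Δ φ} → List.All True Δ → Step Δ φ → True φ
  step-sound ⊨Δ (axiom ax)     μ = axiom-sound ax μ
  step-sound ⊨Δ (MP α∈ α→β∈)   μ = 𝟏≤⇒≈𝟏 (trans
    (reflexive (Eq.sym (List.lookup ⊨Δ α∈ μ)))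
    (⇒≈𝟏⇒≤ (List.lookup ⊨Δ α→β∈ μ)))
  step-sound ⊨Δ (R¬ α↔β∈)      μ = ≈⇒⇔≈𝟏 (¬ᴮ-cong (⇔≈𝟏⇒≈ (List.lookup ⊨Δ α↔β∈ μ)))
  step-sound ⊨Δ (R∘ α↔β∈)      μ = ≈⇒⇔≈𝟏 (∘ᴮ-cong (⇔≈𝟏⇒≈ (List.lookup ⊨Δ α↔β∈ μ)))
  -- The premise is used at `μ [ x ↦ d ]` for every `d`, which is why `True` ranges over all
  -- assignments; the value of `ψ` is the same at each of them.
  step-sound ⊨Δ (∃-In {ψ = ψ} x x∉ψ φ→ψ∈) μ = ≤⇒⇒≈𝟏 (⋁-least _ _ λ d →
    trans (⇒≈𝟏⇒≤ (List.lookup ⊨Δ φ→ψ∈ (μ [ x ↦ d ])))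
          (reflexive (eval-update-fresh d ψ x∉ψ)))
  step-sound ⊨Δ (∀-In {φ = φ} x x∉φ φ→ψ∈) μ = ≤⇒⇒≈𝟏 (⋀-greatest _ _ λ d →
    trans (reflexive (Eq.sym (eval-update-fresh d φ x∉φ)))
          (⇒≈𝟏⇒≤ (List.lookup ⊨Δ φ→ψ∈ (μ [ x ↦ d ]))))

  -- The induction carries truth of the whole list, since a rule may cite any earlier formula.
  derivation-sound : ∀ {Δ} → Derivation Δ → List.All True Δ
  derivation-sound []       = []
  derivation-sound (s ∷ ds) = let ⊨Δ = derivation-sound ds in step-sound ⊨Δ s ∷ ⊨Δ

⊢-sound : ∀ {Ω : Signature} {ι a e} {φ : Formula Ω} → ⊢ φ → Valid ι a e φ
⊢-sound (_ , d) 𝔄 = List.head (derivation-sound 𝔄 d)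

theorem7p14 : ∀ {ℓ} (ι a e : Level) (Ω : Signature) (Γ : Pred (Formula Ω) ℓ) (φ : Formula Ω) →
    Γ ⊢ φ → Entails ι a e Γ φ
theorem7p14 ι a e Ω Γ φ (inj₁ ⊢φ)             = inj₁ (⊢-sound ⊢φ)
-- The same finite list of premises witnesses the entailment, because the implication from its
-- conjunction is itself a theorem.
theorem7p14 ι a e Ω Γ φ (inj₂ (γs , γs∈Γ , d)) = inj₂ (γs , γs∈Γ , ⊢-sound d)
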